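{- Let $\mathbf A$ be a non-trivial algebra of type $\{\land,\lor,\otimes,\oplus,\neg\}$ and $F\subseteq A$. Then the matrix $\langle\mathbf A,F\rangle$ is a reduced model of $\mathcal{LB}$ if and only if $\mathbf A$ is a distributive bilattice isomorphic to $\mathbf{Reg}(\mathbf A)\odot\mathbf{Reg}(\mathbf A)$ such that the following conditions are satisfied: (i) $\mathbf{Reg}(\mathbf A)=\langle \mathrm{Reg}(\mathbf A),\otimes,\oplus\rangle$ is a distributive lattice with top element $\top$ satisfying the property that, for all $a,b\in\mathrm{Reg}(\mathbf A)$ such that $a<_k b$, there is $c\in\mathrm{Reg}(\mathbf A)$ such that $a\oplus c\neq\top$ and $b\oplus c=\top$; (ii) $F=\mathcal{FF}(\top)$, the bifilter of $\mathbf A$ generated by $\top$.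
   Context: A bilattice is an algebra $\langle B,\land,\lor,\otimes,\oplus,\neg\rangle$ such that $\langle B,\land,\lor\rangle$ and $\langle B,\otimes,\oplus\rangle$ are lattices (not necessarily bounded) with associated orders $\leq_t$ and $\leq_k$, and $\neg$ is a unary operation such that for all $a,b$: $a\leq_t b$ implies $\neg b\leq_t\neg a$; $a\leq_k b$ implies $\neg a\leq_k\neg b$; $\neg\neg a=a$. It is distributive if $x\circ(y\bullet z)\approx(x\circ y)\bullet(x\circ z)$ holds for all distinct $\circ,\bullet\in\{\land,\lor,\otimes,\oplus\}$. $\mathrm{Reg}(\mathbf B)=\{a\in B: a=\neg a\}$ is the set of regular elements; it is closed under $\otimes,\oplus$ by the De Morgan laws. A bifilter is a non-empty subset that is a lattice filter with respect to both $\leq_t$ and $\leq_k$; $\mathcal{FF}(\top)$ is the least bifilter containing $\top$. For a lattice $\mathbf L=\langle L,\sqcap,\sqcup\rangle$, the product bilattice $\mathbf L\odot\mathbf L$ has universe $L\times L$ and operations $\langle a_1,a_2\rangle\land\langle b_1,b_2\rangle=\langle a_1\sqcap b_1,a_2\sqcup b_2\rangle$, $\langle a_1,a_2\rangle\lor\langle b_1,b_2\rangle=\langle a_1\sqcup b_1,a_2\sqcap b_2\rangle$, $\langle a_1,a_2\rangle\otimes\langle b_1,b_2\rangle=\langle a_1\sqcap b_1,a_2\sqcap b_2\rangle$, $\langle a_1,a_2\rangle\oplus\langle b_1,b_2\rangle=\langle a_1\sqcup b_1,a_2\sqcup b_2\rangle$, $\neg\langle a_1,a_2\rangle=\langle a_2,a_1\rangle$.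 $\mathcal{FOUR}$ is the bilattice with universe $\{\mathsf f,\bot,\top,\mathsf t\}$ with $\mathsf f <_t \bot,\top <_t \mathsf t$ ($\bot,\top$ $\leq_t$-incomparable), $\bot <_k \mathsf f,\mathsf t <_k \top$ ($\mathsf f,\mathsf t$ $\leq_k$-incomparable), and $\neg \mathsf f = \mathsf t$, $\neg\mathsf t=\mathsf f$, $\neg\bot=\bot$, $\neg\top=\top$. Let $\mathsf{Tr}=\{\top,\mathsf t\}$. $\mathbf{Fm}$ is the formula algebra over a countable set of variables in the language $\{\land,\lor,\otimes,\oplus,\neg\}$, and $\mathcal{LB}$ is the logic given by: $\Gamma\models_{\mathcal{LB}}\varphi$ iff for every homomorphism $h:\mathbf{Fm}\to\mathcal{FOUR}$, $h[\Gamma]\subseteq \mathsf{Tr}$ implies $h(\varphi)\in\mathsf{Tr}$. A matrix $\langle\mathbf A,F\rangle$ ($F\subseteq A$) is a model of $\mathcal{LB}$ if whenever $\Gamma\models_{\mathcal{LB}}\varphi$ and $h:\mathbf{Fm}\to\mathbf A$ is a homomorphism with $h[\Gamma]\subseteq F$, then $h(\varphi)\in F$. It is reduced if the greatest congruence $\theta$ of $\mathbf A$ compatible with $F$ (i.e. $a\in F$, $\langle a,b\rangle\in\theta$ imply $b\in F$) is the identity. -}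

module Defs where

open import Algebra.Core using (Op₁; Op₂)
open import Algebra.Definitions using (Congruent₁; Congruent₂; Involutive; _DistributesOverˡ_)
open import Algebra.Lattice.Bundles using (Lattice)
open import Algebra.Lattice.Structures using (IsLattice; IsDistributiveLattice)
open import Algebra.Morphism.Definitions using (Homomorphic₁; Homomorphic₂)
open import Data.Nat.Base using (ℕ)
open import Data.Product.Base using (Σ-syntax; ∃; ∃₂; _×_; _,_; proj₁; proj₂)
open import Data.Product.Relation.Binary.Pointwise.NonDependent using (Pointwise; ×-isEquivalence)
open import Function.Definitions using (Congruent; Bijective)
open import Level using (Level; _⊔_; suc; 0ℓ)
open import Relation.Binary.Bundles using (Setoid)
open import Relation.Binary.Core using (Rel; _⇒_)
open import Relation.Binary.Definitions using (_Respects_; Maximum)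
open import Relation.Binary.PropositionalEquality.Core using (_≡_; cong; cong₂; _≢_)
open import Relation.Binary.PropositionalEquality.Properties using () renaming (isEquivalence to ≡-isEquivalence)
open import Relation.Binary.Structures using (IsEquivalence)
open import Relation.Unary using (Pred; _∈_; _⊆_; ｛_｝; _∪_)
import Algebra.Lattice.Properties.Lattice as LatticeProperties
import Relation.Binary.Construct.NaturalOrder.Left as NaturalOrder
import Relation.Binary.Construct.NonStrictToStrict as Strict
import Relation.Binary.Construct.On as On
import Relation.Binary.Reasoning.Setoid as ≈-Reasoning

private
  variable
    c c′ ℓ ℓ′ f r : Level

-- The binary symbols ∧, ∨, ⊗, ⊕: meet and join of the truth order ≤ₜ and of
-- the knowledge order ≤ₖ, respectively.
data Connective : Set where
  meetₜ joinₜ meetₖ joinₖ : Connective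

-- Algebras carry a setoid equality, as in the standard library's hierarchy.
record Alg (c ℓ : Level) : Set (suc (c ⊔ ℓ)) where
  infix 4 _≈_
  infixr 7 _∧_ _⊗_
  infixr 6 _∨_ _⊕_
  field
    Carrier       : Set c
    _≈_           : Rel Carrier ℓ
    isEquivalence : IsEquivalence _≈_
    op            : Connective → Op₂ Carrier
    neg           : Op₁ Carrier
    op-cong       : ∀ k → Congruent₂ _≈_ (op k)
    neg-cong      : Congruent₁ _≈_ neg

  setoid : Setoid c ℓ
  setoid = record { isEquivalence = isEquivalence }

  open Setoid setoid public using (_≉_)

  _∧_ _∨_ _⊗_ _⊕_ : Op₂ Carrier
  _∧_ = op meetₜ
  _∨_ = op joinₜ
  _⊗_ = op meetₖ
  _⊕_ = op joinₖ

  -- x ≤ₜ y is x ≈ x ∧ y, and x ≤ₖ y is x ≈ x ⊗ y.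
  open NaturalOrder _≈_ _∧_ public using () renaming (_≤_ to _≤ₜ_)
  open NaturalOrder _≈_ _⊗_ public using () renaming (_≤_ to _≤ₖ_)

NonTrivial : Alg c ℓ → Set (c ⊔ ℓ)
NonTrivial A = ∃₂ λ a b → a ≉ b
  where open Alg A

module _ (A : Alg c ℓ) (B : Alg c′ ℓ′) where
  private
    module A = Alg A
    module B = Alg B

  record IsHomomorphism (h : A.Carrier → B.Carrier) : Set (c ⊔ ℓ ⊔ ℓ′) where
    field
      ⟦⟧-cong  : Congruent A._≈_ B._≈_ h
      op-homo  : ∀ k → Homomorphic₂ A.Carrier B.Carrier B._≈_ h (A.op k) (B.op k)
      neg-homo : Homomorphic₁ A.Carrier B.Carrier B._≈_ h A.neg B.neg

  record IsIsomorphism (h : A.Carrier → B.Carrier) : Set (c ⊔ ℓ ⊔ c′ ⊔ ℓ′) where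
    field
      isHomomorphism : IsHomomorphism h
      bijective      : Bijective A._≈_ B._≈_ h

  Isomorphic : Set (c ⊔ ℓ ⊔ c′ ⊔ ℓ′)
  Isomorphic = ∃ IsIsomorphism

module _ (A : Alg c ℓ) where
  open Alg A

  record IsBilattice : Set (c ⊔ ℓ) where
    field
      ≤ₜ-isLattice    : IsLattice _≈_ _∨_ _∧_
      ≤ₖ-isLattice    : IsLattice _≈_ _⊕_ _⊗_
      neg-antitone    : ∀ {a b} → a ≤ₜ b → neg b ≤ₜ neg a
      neg-monotone    : ∀ {a b} → a ≤ₖ b → neg a ≤ₖ neg b
      neg-involutive  : Involutive _≈_ neg

  record IsDistributiveBilattice : Set (c ⊔ ℓ) where
    field
      isBilattice : IsBilattice
      distributes : ∀ j k → j ≢ k → _DistributesOverˡ_ _≈_ (op j) (op k)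

  record IsBifilter (G : Pred Carrier f) : Set (c ⊔ ℓ ⊔ f) where
    field
      nonEmpty  : ∃ λ a → a ∈ G
      ∧-closed  : ∀ {a b} → a ∈ G → b ∈ G → a ∧ b ∈ G
      ⊗-closed  : ∀ {a b} → a ∈ G → b ∈ G → a ⊗ b ∈ G
      ≤ₜ-closed : ∀ {a b} → a ∈ G → a ≤ₜ b → b ∈ G
      ≤ₖ-closed : ∀ {a b} → a ∈ G → a ≤ₖ b → b ∈ G

  record IsLeastBifilterContaining (x : Carrier) (F : Pred Carrier f) : Set (c ⊔ ℓ ⊔ suc f) where
    field
      isBifilter : IsBifilter F
      contains   : x ∈ F
      least      : ∀ (G : Pred Carrier f) → IsBifilter G → x ∈ G → F ⊆ G

  record IsCongruence (θ : Rel Carrier r) : Set (c ⊔ ℓ ⊔ r) where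
    field
      isEquivalenceᶿ : IsEquivalence θ
      ≈⇒θ            : _≈_ ⇒ θ
      op-congᶿ       : ∀ k → Congruent₂ θ (op k)
      neg-congᶿ      : Congruent₁ θ neg

  record IsGreatestCompatibleCongruence (F : Pred Carrier f) (θ : Rel Carrier r)
         : Set (c ⊔ ℓ ⊔ f ⊔ suc r) where
    field
      isCongruence : IsCongruence θ
      compatible   : F Respects θ
      greatest     : ∀ (θ′ : Rel Carrier r) → IsCongruence θ′ → F Respects θ′ → θ′ ⇒ θ

  IsReduced : Pred Carrier f → Set (c ⊔ suc ℓ ⊔ f)
  IsReduced F = IsGreatestCompatibleCongruence F _≈_

module _ {A : Alg c ℓ} (bl : IsBilattice A) where
  open Alg A
  open IsBilattice bl
  private
    module T = IsLattice ≤ₜ-isLattice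
    module K = IsLattice ≤ₖ-isLattice
    knowledge : Lattice c ℓ
    knowledge = record { isLattice = ≤ₖ-isLattice }
    module KP = LatticeProperties knowledge
    open Setoid setoid using (sym; trans) renaming (refl to ≈-refl)
    open ≈-Reasoning setoid

    ∧→∨ : ∀ {x y} → x ≈ x ⊗ y → x ⊕ y ≈ y
    ∧→∨ {x} {y} x≤y = begin
      x ⊕ y       ≈⟨ K.∨-cong x≤y ≈-refl ⟩
      x ⊗ y ⊕ y   ≈⟨ K.∨-comm _ _ ⟩
      y ⊕ x ⊗ y   ≈⟨ K.∨-cong ≈-refl (K.∧-comm _ _) ⟩
      y ⊕ y ⊗ x   ≈⟨ K.∨-absorbs-∧ y x ⟩
      y           ∎

    ∨→∧ : ∀ {x y} → x ⊕ y ≈ y → x ≤ₖ y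
    ∨→∧ {x} {y} eq = sym (trans (K.∧-cong ≈-refl (sym eq)) (K.∧-absorbs-∨ x y))

    ≤-antisym : ∀ {x y} → x ≤ₖ y → y ≤ₖ x → x ≈ y
    ≤-antisym x≤y y≤x = trans x≤y (trans (K.∧-comm _ _) (sym y≤x))

    ⊗-lowerˡ : ∀ x y → (x ⊗ y) ≤ₖ x
    ⊗-lowerˡ x y = sym (begin
      (x ⊗ y) ⊗ x ≈⟨ K.∧-comm _ _ ⟩
      x ⊗ (x ⊗ y) ≈⟨ K.∧-assoc x x y ⟨
      (x ⊗ x) ⊗ y ≈⟨ K.∧-cong (KP.∧-idem x) ≈-refl ⟩
      x ⊗ y       ∎)

    ⊗-lowerʳ : ∀ x y → (x ⊗ y) ≤ₖ y
    ⊗-lowerʳ x y = sym (begin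
      (x ⊗ y) ⊗ y ≈⟨ K.∧-assoc x y y ⟩
      x ⊗ (y ⊗ y) ≈⟨ K.∧-cong ≈-refl (KP.∧-idem y) ⟩
      x ⊗ y       ∎)

    ⊗-greatest : ∀ {x y z} → z ≤ₖ x → z ≤ₖ y → z ≤ₖ (x ⊗ y)
    ⊗-greatest {x} {y} {z} z≤x z≤y = begin
      z           ≈⟨ z≤y ⟩
      z ⊗ y       ≈⟨ K.∧-cong z≤x ≈-refl ⟩
      (z ⊗ x) ⊗ y ≈⟨ K.∧-assoc z x y ⟩
      z ⊗ (x ⊗ y) ∎

    ⊕-upperˡ : ∀ x y → x ≤ₖ (x ⊕ y)
    ⊕-upperˡ x y = sym (K.∧-absorbs-∨ x y)

    ⊕-upperʳ : ∀ x y → y ≤ₖ (x ⊕ y)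
    ⊕-upperʳ x y = sym (trans (K.∧-cong ≈-refl (K.∨-comm x y)) (K.∧-absorbs-∨ y x))

    ⊕-least : ∀ {x y z} → x ≤ₖ z → y ≤ₖ z → (x ⊕ y) ≤ₖ z
    ⊕-least {x} {y} {z} x≤z y≤z = ∨→∧ (begin
      (x ⊕ y) ⊕ z ≈⟨ K.∨-assoc x y z ⟩
      x ⊕ (y ⊕ z) ≈⟨ K.∨-cong ≈-refl (∧→∨ y≤z) ⟩
      x ⊕ z       ≈⟨ ∧→∨ x≤z ⟩
      z           ∎)

    ≤-respˡ : ∀ {x y z} → x ≈ y → x ≤ₖ z → y ≤ₖ z
    ≤-respˡ x≈y x≤z = trans (sym x≈y) (trans x≤z (K.∧-cong x≈y ≈-refl))

    ≤-respʳ : ∀ {x y z} → x ≈ y → z ≤ₖ x → z ≤ₖ y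
    ≤-respʳ x≈y z≤x = trans z≤x (K.∧-cong ≈-refl x≈y)

    transposeˡ : ∀ {x y} → neg x ≤ₖ y → x ≤ₖ neg y
    transposeˡ p = ≤-respˡ (neg-involutive _) (neg-monotone p)

    transposeʳ : ∀ {x y} → x ≤ₖ neg y → neg x ≤ₖ y
    transposeʳ p = ≤-respʳ (neg-involutive _) (neg-monotone p)

  neg-⊗ : ∀ x y → neg (x ⊗ y) ≈ neg x ⊗ neg y
  neg-⊗ x y = ≤-antisym
    (⊗-greatest (neg-monotone (⊗-lowerˡ x y)) (neg-monotone (⊗-lowerʳ x y)))
    (transposeˡ (⊗-greatest (transposeʳ (⊗-lowerˡ _ _)) (transposeʳ (⊗-lowerʳ _ _))))

  neg-⊕ : ∀ x y → neg (x ⊕ y) ≈ neg x ⊕ neg y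
  neg-⊕ x y = ≤-antisym
    (transposeʳ (⊕-least (transposeˡ (⊕-upperˡ _ _)) (transposeˡ (⊕-upperʳ _ _))))
    (⊕-least (neg-monotone (⊕-upperˡ x y)) (neg-monotone (⊕-upperʳ x y)))

  RegCarrier : Set (c ⊔ ℓ)
  RegCarrier = Σ[ a ∈ Carrier ] a ≈ neg a

  -- Join is ⊕ and meet is ⊗, so the lattice order is the restriction of ≤ₖ.
  -- Equality ignores the regularity proofs.
  Reg : Lattice (c ⊔ ℓ) ℓ
  Reg = record
    { Carrier   = RegCarrier
    ; _≈_       = λ x y → proj₁ x ≈ proj₁ y
    ; _∨_       = λ (a , p) (b , q) → a ⊕ b , trans (K.∨-cong p q) (sym (neg-⊕ a b))
    ; _∧_       = λ (a , p) (b , q) → a ⊗ b , trans (K.∧-cong p q) (sym (neg-⊗ a b))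
    ; isLattice = record
      { isEquivalence = On.isEquivalence proj₁ isEquivalence
      ; ∨-comm        = λ (a , _) (b , _) → K.∨-comm a b
      ; ∨-assoc       = λ (a , _) (b , _) (d , _) → K.∨-assoc a b d
      ; ∨-cong        = K.∨-cong
      ; ∧-comm        = λ (a , _) (b , _) → K.∧-comm a b
      ; ∧-assoc       = λ (a , _) (b , _) (d , _) → K.∧-assoc a b d
      ; ∧-cong        = K.∧-cong
      ; absorptive    = (λ (a , _) (b , _) → K.∨-absorbs-∧ a b)
                      , (λ (a , _) (b , _) → K.∧-absorbs-∨ a b)
      }
    }

module LatticeOrder (L : Lattice c ℓ) where
  open Lattice L
  open NaturalOrder _≈_ _∧_ public using (_≤_)
  open Strict _≈_ _≤_ public using (_<_)

record IsTopSeparatedLattice (L : Lattice c ℓ) (top : Lattice.Carrier L) : Set (c ⊔ ℓ) where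
  open Lattice L renaming (_∨_ to _⊔ᴸ_; _∧_ to _⊓_)
  open LatticeOrder L
  field
    isDistributiveLattice : IsDistributiveLattice _≈_ _⊔ᴸ_ _⊓_
    maximum               : Maximum _≤_ top
    separated             : ∀ {a b} → a < b → ∃ λ d → (a ⊔ᴸ d) ≉ top × (b ⊔ᴸ d) ≈ top

⊙-square : Lattice c ℓ → Alg c ℓ
⊙-square L = record
  { Carrier       = Carrier × Carrier
  ; _≈_           = Pointwise _≈_ _≈_
  ; isEquivalence = ×-isEquivalence (Lattice.isEquivalence L) (Lattice.isEquivalence L)
  ; op            = op
  ; neg           = λ (a₁ , a₂) → a₂ , a₁
  ; op-cong       = op-cong
  ; neg-cong      = λ (p₁ , p₂) → p₂ , p₁
  }
  where
  open Lattice L renaming (_∧_ to _⊓_; _∨_ to _⊔ᴸ_; ∧-cong to ⊓-cong; ∨-cong to ⊔ᴸ-cong)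

  op : Connective → Op₂ (Carrier × Carrier)
  op meetₜ (a₁ , a₂) (b₁ , b₂) = a₁ ⊓ b₁ , a₂ ⊔ᴸ b₂
  op joinₜ (a₁ , a₂) (b₁ , b₂) = a₁ ⊔ᴸ b₁ , a₂ ⊓ b₂
  op meetₖ (a₁ , a₂) (b₁ , b₂) = a₁ ⊓ b₁ , a₂ ⊓ b₂
  op joinₖ (a₁ , a₂) (b₁ , b₂) = a₁ ⊔ᴸ b₁ , a₂ ⊔ᴸ b₂

  op-cong : ∀ k → Congruent₂ (Pointwise _≈_ _≈_) (op k)
  op-cong meetₜ (p₁ , p₂) (q₁ , q₂) = ⊓-cong p₁ q₁ , ⊔ᴸ-cong p₂ q₂
  op-cong joinₜ (p₁ , p₂) (q₁ , q₂) = ⊔ᴸ-cong p₁ q₁ , ⊓-cong p₂ q₂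
  op-cong meetₖ (p₁ , p₂) (q₁ , q₂) = ⊓-cong p₁ q₁ , ⊓-cong p₂ q₂
  op-cong joinₖ (p₁ , p₂) (q₁ , q₂) = ⊔ᴸ-cong p₁ q₁ , ⊔ᴸ-cong p₂ q₂

data Four : Set where
  𝖿 ⊥ ⊤ 𝗍 : Four

FOUR : Alg 0ℓ 0ℓ
FOUR = record
  { Carrier       = Four
  ; _≈_           = _≡_
  ; isEquivalence = ≡-isEquivalence
  ; op            = op
  ; neg           = neg
  ; op-cong       = λ k → cong₂ (op k)
  ; neg-cong      = cong neg
  }
  where
  op : Connective → Op₂ Four
  op meetₜ 𝖿 _ = 𝖿
  op meetₜ 𝗍 y = y
  op meetₜ ⊥ 𝖿 = 𝖿
  op meetₜ ⊥ ⊥ = ⊥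
  op meetₜ ⊥ ⊤ = 𝖿
  op meetₜ ⊥ 𝗍 = ⊥
  op meetₜ ⊤ 𝖿 = 𝖿
  op meetₜ ⊤ ⊥ = 𝖿
  op meetₜ ⊤ ⊤ = ⊤
  op meetₜ ⊤ 𝗍 = ⊤
  op joinₜ 𝖿 y = y
  op joinₜ 𝗍 _ = 𝗍
  op joinₜ ⊥ 𝖿 = ⊥
  op joinₜ ⊥ ⊥ = ⊥
  op joinₜ ⊥ ⊤ = 𝗍
  op joinₜ ⊥ 𝗍 = 𝗍
  op joinₜ ⊤ 𝖿 = ⊤
  op joinₜ ⊤ ⊥ = 𝗍
  op joinₜ ⊤ ⊤ = ⊤
  op joinₜ ⊤ 𝗍 = 𝗍
  op meetₖ ⊥ _ = ⊥
  op meetₖ ⊤ y = y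
  op meetₖ 𝖿 𝖿 = 𝖿
  op meetₖ 𝖿 ⊥ = ⊥
  op meetₖ 𝖿 ⊤ = 𝖿
  op meetₖ 𝖿 𝗍 = ⊥
  op meetₖ 𝗍 𝖿 = ⊥
  op meetₖ 𝗍 ⊥ = ⊥
  op meetₖ 𝗍 ⊤ = 𝗍
  op meetₖ 𝗍 𝗍 = 𝗍
  op joinₖ ⊥ y = y
  op joinₖ ⊤ _ = ⊤
  op joinₖ 𝖿 𝖿 = 𝖿
  op joinₖ 𝖿 ⊥ = 𝖿
  op joinₖ 𝖿 ⊤ = ⊤
  op joinₖ 𝖿 𝗍 = ⊤
  op joinₖ 𝗍 𝖿 = ⊤
  op joinₖ 𝗍 ⊥ = 𝗍
  op joinₖ 𝗍 ⊤ = ⊤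
  op joinₖ 𝗍 𝗍 = 𝗍

  neg : Op₁ Four
  neg 𝖿 = 𝗍
  neg ⊥ = ⊥
  neg ⊤ = ⊤
  neg 𝗍 = 𝖿

Tr : Pred Four 0ℓ
Tr = ｛ ⊤ ｝ ∪ ｛ 𝗍 ｝

data Formula : Set where
  var  : ℕ → Formula
  node : Connective → Formula → Formula → Formula
  neg  : Formula → Formula

Fm : Alg 0ℓ 0ℓ
Fm = record
  { Carrier       = Formula
  ; _≈_           = _≡_
  ; isEquivalence = ≡-isEquivalence
  ; op            = node
  ; neg           = neg
  ; op-cong       = λ k → cong₂ (node k)
  ; neg-cong      = cong neg
  }

infix 4 _⊨_

_⊨_ : Pred Formula f → Formula → Set f
Γ ⊨ φ = ∀ h → IsHomomorphism Fm FOUR h → (∀ {γ} → γ ∈ Γ → h γ ∈ Tr) → h φ ∈ Tr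

module _ (A : Alg c ℓ) (F : Pred (Alg.Carrier A) f) where
  open Alg A

  IsModel : Set (c ⊔ ℓ ⊔ suc f)
  IsModel = ∀ (Γ : Pred Formula f) φ → Γ ⊨ φ →
            ∀ h → IsHomomorphism Fm A h → (∀ {γ} → γ ∈ Γ → h γ ∈ F) → h φ ∈ F

  IsReducedModel : Set (c ⊔ suc ℓ ⊔ suc f)
  IsReducedModel = IsModel × IsReduced A F

{-# OPTIONS --safe #-}
module Submission where

open import Axiom.ExcludedMiddle using (ExcludedMiddle)
open import Data.Product.Base using (Σ-syntax; ∃; _×_; _,_; proj₁; proj₂)
open import Function.Bundles using (_⇔_; mk⇔)
open import Level using (Level; Lift; lift)
open import Relation.Binary.Definitions using (_Respects_; DecidableEquality; Maximum; Reflexive; Transitive)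
open import Relation.Unary using (Pred; _∈_; _∉_; Decidable)
open import Algebra.Lattice.Bundles using (Lattice)
open import Algebra.Lattice.Structures using (IsDistributiveLattice)
open import Defs
open import Data.Bool.Base using (Bool; true; false; if_then_else_) renaming (_∧_ to _∧ᵇ_; _∨_ to _∨ᵇ_)
open import Data.Bool.Properties using (∨-∧-lattice) renaming (_≟_ to _≟ᵇ_)
open import Data.Nat.Base using (ℕ; zero; suc; _≤′_; ≤′-reflexive; ≤′-step) renaming (_⊔_ to _⊔ⁿ_)
open import Data.Nat.Properties using (≤⇒≤′; z≤′n; m≤m⊔n; m≤n⊔m)
open import Data.Product.Properties using (≡-dec)
open import Data.Unit.Base using () renaming (⊤ to Unit)
open import Data.Sum.Base using (_⊎_; inj₁; inj₂)
open import Function.Base using (_∘_; id)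
open import Relation.Binary.Core using (Rel)
open import Relation.Binary.PropositionalEquality.Core using (_≡_; refl; sym; trans; cong; cong₂; subst)
open import Relation.Binary.Structures using (IsEquivalence)
open import Relation.Nullary using (Dec; does; yes; no; ¬_; contradiction; map′; _×-dec_; _→-dec_; _⊎-dec_)
open import Relation.Nullary.Decidable using (True; toWitness; from-yes; decidable-stable)
import Algebra.Lattice.Properties.Lattice as LatticeProperties
import Relation.Binary.Lattice as OrderTheoretic
import Relation.Binary.Reasoning.Setoid as ≈-Reasoning

-- In a model of LB, "a ∨ c ∈ F iff b ∨ c ∈ F, and ¬a ∨ c ∈ F iff ¬b ∨ c ∈ F, for all c"
-- defines a congruence compatible with F; when the model is reduced it is the identity, so A
-- satisfies every identity of FOUR. The term reg sends ⟨a₁,a₂⟩ to ⟨a₁,a₁⟩, so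
-- a ↦ ⟨reg a, reg (¬a)⟩ is the isomorphism, ⊤ is reg a for any a ∈ F, and the element c
-- showing that a <ₖ b are not congruent yields the separating element reg c.
--
-- Conversely, in L ⊙ L with F = {⟨⊤,x⟩} separation makes compatible congruences trivial. If F
-- contains the values of Γ but not that of φ, the ideal generated by the first coordinate of φ
-- is extended, one variable at a time, to an ideal that is prime on the sublattice generated
-- by the coordinates of the variables; this gives a valuation in FOUR refuting Γ ⊨ φ. As there
-- are only countably many variables, excluded middle suffices and no choice is needed.

private
  variable
    c c′ ℓ ℓ′ f : Level

-- Evaluation of formulas, homomorphisms and substitution.

module Evaluation (B : Alg c ℓ) where
  open Alg B renaming (neg to ∼_)
  open IsEquivalence isEquivalence using () renaming (refl to ≈-refl)

  ⟦_⟧ : Formula → (ℕ → Carrier) → Carrier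
  ⟦ var n ⟧      v = v n
  ⟦ node k φ ψ ⟧ v = op k (⟦ φ ⟧ v) (⟦ ψ ⟧ v)
  ⟦ neg φ ⟧      v = ∼ ⟦ φ ⟧ v

  ⟦⟧-cong : ∀ φ {v w} → (∀ n → v n ≈ w n) → ⟦ φ ⟧ v ≈ ⟦ φ ⟧ w
  ⟦⟧-cong (var n)      v≈w = v≈w n
  ⟦⟧-cong (node k φ ψ) v≈w = op-cong k (⟦⟧-cong φ v≈w) (⟦⟧-cong ψ v≈w)
  ⟦⟧-cong (neg φ)      v≈w = neg-cong (⟦⟧-cong φ v≈w)

  ⟦⟧-isHomomorphism : ∀ v → IsHomomorphism Fm B (λ φ → ⟦ φ ⟧ v)
  ⟦⟧-isHomomorphism v = record
    { ⟦⟧-cong  = λ { refl → ≈-refl }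
    ; op-homo  = λ _ _ _ → ≈-refl
    ; neg-homo = λ _ → ≈-refl
    }

open Evaluation using (⟦_⟧; ⟦⟧-cong; ⟦⟧-isHomomorphism)

module _ {B : Alg c ℓ} {C : Alg c′ ℓ′} {h : Alg.Carrier B → Alg.Carrier C}
         (isHom : IsHomomorphism B C h) where
  open Alg C
  open IsHomomorphism isHom
  open IsEquivalence isEquivalence renaming (refl to ≈-refl; trans to ≈-trans)

  ⟦⟧-natural : ∀ φ v → h (⟦ B ⟧ φ v) ≈ ⟦ C ⟧ φ (h ∘ v)
  ⟦⟧-natural (var n)      v = ≈-refl
  ⟦⟧-natural (node k φ ψ) v =
    ≈-trans (op-homo k _ _) (op-cong k (⟦⟧-natural φ v) (⟦⟧-natural ψ v))
  ⟦⟧-natural (neg φ)      v = ≈-trans (neg-homo _) (neg-cong (⟦⟧-natural φ v))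

⟦⟧-var : ∀ φ → ⟦ Fm ⟧ φ var ≡ φ
⟦⟧-var (var n)      = refl
⟦⟧-var (node k φ ψ) = cong₂ (node k) (⟦⟧-var φ) (⟦⟧-var ψ)
⟦⟧-var (neg φ)      = cong neg (⟦⟧-var φ)

-- By naturality along `h`, since evaluating a formula at `var` in `Fm` returns the formula itself.
hom-⟦⟧ : ∀ (B : Alg c ℓ) {h} → IsHomomorphism Fm B h → ∀ φ →
  Alg._≈_ B (h φ) (⟦ B ⟧ φ (h ∘ var))
hom-⟦⟧ B {h} isHom φ =
  subst (λ ψ → Alg._≈_ B (h ψ) (⟦ B ⟧ φ (h ∘ var))) (⟦⟧-var φ) (⟦⟧-natural isHom φ var)

-- From index 3 on, the valuation is constant.
env : {X : Set c} → X → X → X → X → ℕ → X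
env x y z w 0 = x
env x y z w 1 = y
env x y z w 2 = z
env x y z w _ = w

-- Reduces the value of any formula to four elements of `B`, so that finite truth tables can speak
-- about all homomorphisms.
⟦⟧-substitute : ∀ (B : Alg c ℓ) {h} → IsHomomorphism Fm B h → ∀ φ x y z w →
  Alg._≈_ B (h (⟦ Fm ⟧ φ (env x y z w))) (⟦ B ⟧ φ (env (h x) (h y) (h z) (h w)))
⟦⟧-substitute B {h} isHom φ x y z w =
  ≈-trans (⟦⟧-natural isHom φ (env x y z w)) (⟦⟧-cong B φ pointwise)
  where
  open Alg B
  open IsEquivalence isEquivalence renaming (refl to ≈-refl; trans to ≈-trans)

  pointwise : ∀ n → h (env x y z w n) ≈ env (h x) (h y) (h z) (h w) n
  pointwise 0 = ≈-refl
  pointwise 1 = ≈-refl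
  pointwise 2 = ≈-refl
  pointwise (suc (suc (suc _))) = ≈-refl

-- The four-element bilattice and its truth tables.

-- FOUR as the square of the two-element lattice, Tr being the first coordinate.
fromBits : Bool × Bool → Four
fromBits (false , false) = ⊥
fromBits (false , true)  = 𝖿
fromBits (true  , false) = 𝗍
fromBits (true  , true)  = ⊤

toBits : Four → Bool × Bool
toBits 𝖿 = false , true
toBits ⊥ = false , false
toBits ⊤ = true , true
toBits 𝗍 = true , false

fromBits∘toBits : ∀ x → fromBits (toBits x) ≡ x
fromBits∘toBits 𝖿 = refl
fromBits∘toBits ⊥ = refl
fromBits∘toBits ⊤ = refl
fromBits∘toBits 𝗍 = refl

toBits∘fromBits : ∀ b → toBits (fromBits b) ≡ b
toBits∘fromBits (false , false) = refl
toBits∘fromBits (false , true)  = refl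
toBits∘fromBits (true  , false) = refl
toBits∘fromBits (true  , true)  = refl

_≟_ : DecidableEquality Four
x ≟ y = map′
  (λ eq → trans (sym (fromBits∘toBits x)) (trans (cong fromBits eq) (fromBits∘toBits y)))
  (cong toBits) (≡-dec _≟ᵇ_ _≟ᵇ_ (toBits x) (toBits y))

Tr? : Decidable Tr
Tr? x = (⊤ ≟ x) ⊎-dec (𝗍 ≟ x)

∀Four? : {P : Pred Four ℓ} → Decidable P → Dec (∀ x → P x)
∀Four? P? = map′
  (λ { (p , q , r , s) → λ { 𝖿 → p ; ⊥ → q ; ⊤ → r ; 𝗍 → s } })
  (λ p → p 𝖿 , p ⊥ , p ⊤ , p 𝗍)
  (P? 𝖿 ×-dec P? ⊥ ×-dec P? ⊤ ×-dec P? 𝗍)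

∀Connective? : {P : Pred Connective ℓ} → Decidable P → Dec (∀ k → P k)
∀Connective? P? = map′
  (λ { (p , q , r , s) → λ { meetₜ → p ; joinₜ → q ; meetₖ → r ; joinₖ → s } })
  (λ p → p meetₜ , p joinₜ , p meetₖ , p joinₖ)
  (P? meetₜ ×-dec P? joinₜ ×-dec P? meetₖ ×-dec P? joinₖ)

toBits-op : ∀ k x y →
  toBits (Alg.op FOUR k x y) ≡ Alg.op (⊙-square ∨-∧-lattice) k (toBits x) (toBits y)
toBits-op = from-yes (∀Connective? λ k → ∀Four? λ x → ∀Four? λ y → ≡-dec _≟ᵇ_ _≟ᵇ_
  (toBits (Alg.op FOUR k x y)) (Alg.op (⊙-square ∨-∧-lattice) k (toBits x) (toBits y)))

toBits-neg : ∀ x → toBits (Alg.neg FOUR x) ≡ Alg.neg (⊙-square ∨-∧-lattice) (toBits x)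
toBits-neg = from-yes (∀Four? λ x → ≡-dec _≟ᵇ_ _≟ᵇ_
  (toBits (Alg.neg FOUR x)) (Alg.neg (⊙-square ∨-∧-lattice) (toBits x)))

-- Only valuations `env x y z w` are tested, so a table of 256 rows decides it.
Entailment : (α β φ : Formula) → Set
Entailment α β φ = ∀ x y z w → ⟦ FOUR ⟧ α (env x y z w) ∈ Tr →
  ⟦ FOUR ⟧ β (env x y z w) ∈ Tr → ⟦ FOUR ⟧ φ (env x y z w) ∈ Tr

entailment? : ∀ α β φ → Dec (Entailment α β φ)
entailment? α β φ = ∀Four? λ x → ∀Four? λ y → ∀Four? λ z → ∀Four? λ w →
  Tr? (⟦ FOUR ⟧ α (env x y z w)) →-dec
  (Tr? (⟦ FOUR ⟧ β (env x y z w)) →-dec Tr? (⟦ FOUR ⟧ φ (env x y z w)))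

Identity : (φ ψ : Formula) → Set
Identity φ ψ = ∀ x y z → ⟦ FOUR ⟧ φ (env x y z z) ≡ ⟦ FOUR ⟧ ψ (env x y z z)

identity? : ∀ φ ψ → Dec (Identity φ ψ)
identity? φ ψ = ∀Four? λ x → ∀Four? λ y → ∀Four? λ z →
  ⟦ FOUR ⟧ φ (env x y z z) ≟ ⟦ FOUR ⟧ ψ (env x y z z)

private
  module Fm = Alg Fm
  module F₄ = Alg FOUR

  p q r s : Formula
  p = var 0
  q = var 1
  r = var 2
  s = var 3

-- Terms describing the regular part.

module RegularPart (B : Alg c ℓ) where
  open Alg B renaming (neg to ∼_)

  -- In a square these are ⟨a₁,a₂⟩ ↦ ⟨a₁,a₁⊓a₂⟩, ⟨a₁,a₂⟩ ↦ ⟨a₁,a₁⟩ and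
  -- ⟨x,x⟩, ⟨y,y⟩ ↦ ⟨x,y⟩.
  half reg : Carrier → Carrier
  half a = a ∨ (a ⊗ ∼ a)
  reg a = half a ⊕ ∼ half a

  pair : Carrier → Carrier → Carrier
  pair x y = (x ⊗ (x ∨ y)) ⊕ (y ⊗ (x ∧ y))

  half-cong : ∀ {a b} → a ≈ b → half a ≈ half b
  half-cong a≈b = op-cong joinₜ a≈b (op-cong meetₖ a≈b (neg-cong a≈b))

  reg-cong : ∀ {a b} → a ≈ b → reg a ≈ reg b
  reg-cong a≈b = op-cong joinₖ (half-cong a≈b) (neg-cong (half-cong a≈b))

  pair-cong : ∀ {x y x′ y′} → x ≈ x′ → y ≈ y′ → pair x y ≈ pair x′ y′
  pair-cong x≈x′ y≈y′ = op-cong joinₖ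
    (op-cong meetₖ x≈x′ (op-cong joinₜ x≈x′ y≈y′))
    (op-cong meetₖ y≈y′ (op-cong meetₜ x≈x′ y≈y′))

private
  module FmReg = RegularPart Fm

-- Reduced models: consequences of LB as closure properties of `F`.

module ReducedModel
  (em : ExcludedMiddle ℓ) (A : Alg ℓ ℓ) (nonTrivial : NonTrivial A)
  (F : Pred (Alg.Carrier A) ℓ) (F-resp : F Respects Alg._≈_ A)
  (isModel : IsModel A F) (isReduced : IsReduced A F)
  where

  open Alg A renaming (neg to ∼_)
  open IsEquivalence isEquivalence
    renaming (refl to ≈-refl; sym to ≈-sym; trans to ≈-trans)
  open IsGreatestCompatibleCongruence isReduced using (greatest)
  open RegularPart A
  open ≈-Reasoning setoid

  F-consequence : ∀ α β φ →
    (∀ h → IsHomomorphism Fm FOUR h → h α ∈ Tr → h β ∈ Tr → h φ ∈ Tr) →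
    ∀ v → ⟦ A ⟧ α v ∈ F → ⟦ A ⟧ β v ∈ F → ⟦ A ⟧ φ v ∈ F
  F-consequence α β φ α,β⊨φ v α∈F β∈F = isModel
    -- `Lift` brings the set of the two premises to the level over which `IsModel` quantifies.
    (λ γ → Lift _ (α ≡ γ ⊎ β ≡ γ)) φ
    (λ h isHom Γ⊆Tr → α,β⊨φ h isHom (Γ⊆Tr (lift (inj₁ refl))) (Γ⊆Tr (lift (inj₂ refl))))
    (λ γ → ⟦ A ⟧ γ v) (⟦⟧-isHomomorphism A v)
    (λ { (lift (inj₁ refl)) → α∈F ; (lift (inj₂ refl)) → β∈F })

  -- `Entailment` covers only valuations of the form `env x y z w`, while consequence ranges over
  -- all homomorphisms. Substituting `env p q r s` first makes the two agree.
  F-entails : ∀ α β φ → Entailment α β φ → ∀ a b c d →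
    ⟦ A ⟧ α (env a b c d) ∈ F → ⟦ A ⟧ β (env a b c d) ∈ F → ⟦ A ⟧ φ (env a b c d) ∈ F
  F-entails α β φ valid a b c d α∈F β∈F = F-resp (interpret φ)
    (F-consequence (restrict α) (restrict β) (restrict φ) restricted (env a b c d)
      (F-resp (≈-sym (interpret α)) α∈F) (F-resp (≈-sym (interpret β)) β∈F))
    where
    restrict : Formula → Formula
    restrict γ = ⟦ Fm ⟧ γ (env p q r s)

    interpret : ∀ γ → ⟦ A ⟧ (restrict γ) (env a b c d) ≈ ⟦ A ⟧ γ (env a b c d)
    interpret γ = ⟦⟧-substitute A (⟦⟧-isHomomorphism A (env a b c d)) γ p q r s

    restricted : ∀ h → IsHomomorphism Fm FOUR h →
      h (restrict α) ∈ Tr → h (restrict β) ∈ Tr → h (restrict φ) ∈ Tr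
    restricted h isHom
      rewrite ⟦⟧-substitute FOUR isHom α p q r s
            | ⟦⟧-substitute FOUR isHom β p q r s
            | ⟦⟧-substitute FOUR isHom φ p q r s
      = valid (h p) (h q) (h r) (h s)

  -- At concrete formulas the implicit argument is filled by computing the truth table during type
  -- checking.
  F-entails₁ : ∀ α φ {_ : True (entailment? α α φ)} → ∀ a b c d →
    ⟦ A ⟧ α (env a b c d) ∈ F → ⟦ A ⟧ φ (env a b c d) ∈ F
  F-entails₁ α φ {valid} a b c d α∈F = F-entails α α φ (toWitness valid) a b c d α∈F α∈F

  F-entails₂ : ∀ α β φ {_ : True (entailment? α β φ)} → ∀ a b c d →
    ⟦ A ⟧ α (env a b c d) ∈ F → ⟦ A ⟧ β (env a b c d) ∈ F → ⟦ A ⟧ φ (env a b c d) ∈ F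
  F-entails₂ α β φ {valid} = F-entails α β φ (toWitness valid)

  -- The compatible congruence and the identities it yields.

  infix 4 _≼_ _⊑_ _≃_

  _≼_ _⊑_ _≃_ : Rel Carrier ℓ
  a ≼ b = ∀ c → a ∨ c ∈ F → b ∨ c ∈ F
  a ⊑ b = a ≼ b × ∼ a ≼ ∼ b
  a ≃ b = a ⊑ b × b ⊑ a

  ⊑-refl : Reflexive _⊑_
  ⊑-refl = (λ _ → id) , (λ _ → id)

  ⊑-trans : Transitive _⊑_
  ⊑-trans (f , g) (f′ , g′) = (λ c → f′ c ∘ f c) , (λ c → g′ c ∘ g c)

  ≃-isEquivalence : IsEquivalence _≃_
  ≃-isEquivalence = record
    { refl  = ⊑-refl , ⊑-refl
    ; sym   = λ (f , g) → g , f
    ; trans = λ (f , g) (f′ , g′) → ⊑-trans f f′ , ⊑-trans g′ g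
    }

  ≼-reflexive : ∀ {a b} → a ≈ b → a ≼ b
  ≼-reflexive a≈b c = F-resp (op-cong joinₜ a≈b ≈-refl)

  ≈⇒⊑ : ∀ {a b} → a ≈ b → a ⊑ b
  ≈⇒⊑ a≈b = ≼-reflexive a≈b , ≼-reflexive (neg-cong a≈b)

  ≈⇒≃ : ∀ {a b} → a ≈ b → a ≃ b
  ≈⇒≃ a≈b = ≈⇒⊑ a≈b , ≈⇒⊑ (≈-sym a≈b)

  -- Terms that agree in `FOUR` still agree after negation and after `∨ s`, so each test formula
  -- entails its counterpart.
  identity⇒⊑ : ∀ φ ψ → Identity φ ψ → ∀ a b c →
    ⟦ A ⟧ φ (env a b c c) ⊑ ⟦ A ⟧ ψ (env a b c c)
  identity⇒⊑ φ ψ valid a b c =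
      (λ d φ∨d → F-resp (op-cong joinₜ (interpret A ψ a b c d) ≈-refl)
        (transfer (φ′ Fm.∨ s) (ψ′ Fm.∨ s)
          (λ x y z w → cong (F₄._∨ w) (restricted x y z w)) d
          (F-resp (op-cong joinₜ (≈-sym (interpret A φ a b c d)) ≈-refl) φ∨d)))
    , (λ d ∼φ∨d → F-resp (op-cong joinₜ (neg-cong (interpret A ψ a b c d)) ≈-refl)
        (transfer (Formula.neg φ′ Fm.∨ s) (Formula.neg ψ′ Fm.∨ s)
          (λ x y z w → cong (λ u → F₄.neg u F₄.∨ w) (restricted x y z w)) d
          (F-resp (op-cong joinₜ (neg-cong (≈-sym (interpret A φ a b c d))) ≈-refl) ∼φ∨d)))
    where
    -- Keeps the fourth variable free for the disjunct d.
    φ′ ψ′ : Formula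
    φ′ = ⟦ Fm ⟧ φ (env p q r r)
    ψ′ = ⟦ Fm ⟧ ψ (env p q r r)

    interpret : ∀ {ℓ₁ ℓ₂} (B : Alg ℓ₁ ℓ₂) γ x y z w →
      Alg._≈_ B (⟦ B ⟧ (⟦ Fm ⟧ γ (env p q r r)) (env x y z w)) (⟦ B ⟧ γ (env x y z z))
    interpret B γ x y z w = ⟦⟧-substitute B (⟦⟧-isHomomorphism B (env x y z w)) γ p q r r

    restricted : ∀ x y z w → ⟦ FOUR ⟧ φ′ (env x y z w) ≡ ⟦ FOUR ⟧ ψ′ (env x y z w)
    restricted x y z w = trans (interpret FOUR φ x y z w)
      (trans (valid x y z) (sym (interpret FOUR ψ x y z w)))

    transfer : ∀ α β → (∀ x y z w → ⟦ FOUR ⟧ α (env x y z w) ≡ ⟦ FOUR ⟧ β (env x y z w)) →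
      ∀ d → ⟦ A ⟧ α (env a b c d) ∈ F → ⟦ A ⟧ β (env a b c d) ∈ F
    transfer α β α≡β d α∈F = F-entails α α β
      (λ x y z w α∈Tr _ → subst (_∈ Tr) (α≡β x y z w) α∈Tr) a b c d α∈F α∈F

  identity⇒≃ : ∀ φ ψ → Identity φ ψ → ∀ a b c →
    ⟦ A ⟧ φ (env a b c c) ≃ ⟦ A ⟧ ψ (env a b c c)
  identity⇒≃ φ ψ valid a b c =
    identity⇒⊑ φ ψ valid a b c , identity⇒⊑ ψ φ (λ x y z → sym (valid x y z)) a b c

  -- In FOUR, a formula C[x] = ± (op k x d) ∨ e satisfies C[a] ⊨ ± a ∨ C[b] and
  -- C[a], ± b ∨ C[b] ⊨ C[b]; hence C[b] itself serves as the disjunct testing a ⊑ b.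
  op-⊑ : ∀ k {a b} d → a ⊑ b → op k a d ⊑ op k b d
  op-⊑ k {a} {b} d (a≼b , ∼a≼∼b) =
      (λ e → replace e p q (C k p) (C k q) (C-entails k) (C-entailed k) a≼b)
    , (λ e → replace e (Formula.neg p) (Formula.neg q) (D k p) (D k q)
        (D-entails k) (D-entailed k) ∼a≼∼b)
    where
    replace : ∀ e x y α β → Entailment α α (x Fm.∨ β) → Entailment α (y Fm.∨ β) β →
      ⟦ A ⟧ x (env a b d e) ≼ ⟦ A ⟧ y (env a b d e) →
      ⟦ A ⟧ α (env a b d e) ∈ F → ⟦ A ⟧ β (env a b d e) ∈ F
    replace e x y α β α⊨x∨β α,y∨β⊨β x≼y α∈F = F-entails α (y Fm.∨ β) β α,y∨β⊨β a b d e α∈F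
      (x≼y _ (F-entails α α (x Fm.∨ β) α⊨x∨β a b d e α∈F α∈F))

    C D : Connective → Formula → Formula
    C k x = node k x r Fm.∨ s
    D k x = Formula.neg (node k x r) Fm.∨ s

    C-entails : ∀ k → Entailment (C k p) (C k p) (p Fm.∨ C k q)
    C-entails = from-yes (∀Connective? λ k → entailment? (C k p) (C k p) (p Fm.∨ C k q))

    C-entailed : ∀ k → Entailment (C k p) (q Fm.∨ C k q) (C k q)
    C-entailed = from-yes (∀Connective? λ k → entailment? (C k p) (q Fm.∨ C k q) (C k q))

    D-entails : ∀ k → Entailment (D k p) (D k p) (Formula.neg p Fm.∨ D k q)
    D-entails = from-yes (∀Connective? λ k →
      entailment? (D k p) (D k p) (Formula.neg p Fm.∨ D k q))

    D-entailed : ∀ k → Entailment (D k p) (Formula.neg q Fm.∨ D k q) (D k q)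
    D-entailed = from-yes (∀Connective? λ k →
      entailment? (D k p) (Formula.neg q Fm.∨ D k q) (D k q))

  -- The second component compares double negations. `∼ ∼ a ≈ a` is not yet available, but `¬¬p ∨ q`
  -- and `p ∨ q` entail each other in `FOUR`.
  neg-⊑ : ∀ {a b} → a ⊑ b → ∼ a ⊑ ∼ b
  neg-⊑ {a} {b} (a≼b , ∼a≼∼b) = ∼a≼∼b , λ e ∼∼a∈F →
    F-entails₁ (p Fm.∨ q) (Formula.neg (Formula.neg p) Fm.∨ q) b e e e
      (a≼b e (F-entails₁ (Formula.neg (Formula.neg p) Fm.∨ q) (p Fm.∨ q) a e e e ∼∼a∈F))

  op-≃ˡ : ∀ k {a b} d → a ≃ b → op k a d ≃ op k b d
  op-≃ˡ k d (a⊑b , b⊑a) = op-⊑ k d a⊑b , op-⊑ k d b⊑a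

  -- Turns compatibility in the left argument into compatibility in the right one.
  op-comm-≃ : ∀ k a b → op k a b ≃ op k b a
  op-comm-≃ k a b = identity⇒≃ (node k p q) (node k q p) (comm k) a b b
    where
    comm : ∀ k → Identity (node k p q) (node k q p)
    comm = from-yes (∀Connective? λ k → identity? (node k p q) (node k q p))

  ≃-isCongruence : IsCongruence A _≃_
  ≃-isCongruence = record
    { isEquivalenceᶿ = ≃-isEquivalence
    ; ≈⇒θ            = ≈⇒≃
    ; op-congᶿ       = λ k {a} {a′} {b} {b′} a≃a′ b≃b′ → ≃-trans (op-≃ˡ k b a≃a′)
        (≃-trans (op-comm-≃ k a′ b) (≃-trans (op-≃ˡ k a′ b≃b′) (op-comm-≃ k b′ a′)))
    ; neg-congᶿ      = λ (a⊑b , b⊑a) → neg-⊑ a⊑b , neg-⊑ b⊑a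
    }
    where open IsEquivalence ≃-isEquivalence using () renaming (trans to ≃-trans)

  -- The disjunct is `b` itself: `a` entails `a ∨ b`, which gives `b ∨ b`, which entails `b`.
  ≃-compatible : F Respects _≃_
  ≃-compatible {a} {b} ((a≼b , _) , _) a∈F =
    F-entails₁ (p Fm.∨ p) p b b b b (a≼b b (F-entails₁ p (p Fm.∨ q) a b b b a∈F))

  ≃⇒≈ : ∀ {a b} → a ≃ b → a ≈ b
  ≃⇒≈ = greatest _≃_ ≃-isCongruence ≃-compatible

  identity⇒≈ : ∀ φ ψ → Identity φ ψ → ∀ a b c → ⟦ A ⟧ φ (env a b c c) ≈ ⟦ A ⟧ ψ (env a b c c)
  identity⇒≈ φ ψ valid a b c = ≃⇒≈ (identity⇒≃ φ ψ valid a b c)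

  identity : ∀ φ ψ {_ : True (identity? φ ψ)} → ∀ a b c →
    ⟦ A ⟧ φ (env a b c c) ≈ ⟦ A ⟧ ψ (env a b c c)
  identity φ ψ {valid} = identity⇒≈ φ ψ (toWitness valid)

  -- The distributive bilattice structure.

  -- Unfolding these proofs makes the comparison of types mentioning Reg isBilattice slow.
  abstract
    isBilattice : IsBilattice A
    isBilattice = record
      { ≤ₜ-isLattice = record
        { isEquivalence = isEquivalence
        ; ∨-comm        = λ a b → identity (p Fm.∨ q) (q Fm.∨ p) a b b
        ; ∨-assoc       = identity ((p Fm.∨ q) Fm.∨ r) (p Fm.∨ (q Fm.∨ r))
        ; ∨-cong        = op-cong joinₜ
        ; ∧-comm        = λ a b → identity (p Fm.∧ q) (q Fm.∧ p) a b b
        ; ∧-assoc       = identity ((p Fm.∧ q) Fm.∧ r) (p Fm.∧ (q Fm.∧ r))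
        ; ∧-cong        = op-cong meetₜ
        ; absorptive    = (λ a b → identity (p Fm.∨ (p Fm.∧ q)) p a b b)
                        , (λ a b → identity (p Fm.∧ (p Fm.∨ q)) p a b b)
        }
      ; ≤ₖ-isLattice = record
        { isEquivalence = isEquivalence
        ; ∨-comm        = λ a b → identity (p Fm.⊕ q) (q Fm.⊕ p) a b b
        ; ∨-assoc       = identity ((p Fm.⊕ q) Fm.⊕ r) (p Fm.⊕ (q Fm.⊕ r))
        ; ∨-cong        = op-cong joinₖ
        ; ∧-comm        = λ a b → identity (p Fm.⊗ q) (q Fm.⊗ p) a b b
        ; ∧-assoc       = identity ((p Fm.⊗ q) Fm.⊗ r) (p Fm.⊗ (q Fm.⊗ r))
        ; ∧-cong        = op-cong meetₖ
        ; absorptive    = (λ a b → identity (p Fm.⊕ (p Fm.⊗ q)) p a b b)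
                        , (λ a b → identity (p Fm.⊗ (p Fm.⊕ q)) p a b b)
        }
      -- The order is a hypothesis, not an identity; here and for `≤ₖ`, replacing `a` by its meet
      -- with `b` leaves an identity of `FOUR`.
      ; neg-antitone = λ {a} {b} a≤b → begin
          ∼ b              ≈⟨ identity (Formula.neg q)
                                (Formula.neg q Fm.∧ Formula.neg (p Fm.∧ q)) a b b ⟩
          ∼ b ∧ ∼ (a ∧ b)  ≈⟨ op-cong meetₜ ≈-refl (neg-cong a≤b) ⟨
          ∼ b ∧ ∼ a        ∎
      ; neg-monotone = λ {a} {b} a≤b → begin
          ∼ a              ≈⟨ neg-cong a≤b ⟩
          ∼ (a ⊗ b)        ≈⟨ identity (Formula.neg (p Fm.⊗ q))
                                (Formula.neg (p Fm.⊗ q) Fm.⊗ Formula.neg q) a b b ⟩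
          ∼ (a ⊗ b) ⊗ ∼ b  ≈⟨ op-cong meetₖ (neg-cong a≤b) ≈-refl ⟨
          ∼ a ⊗ ∼ b        ∎
      ; neg-involutive = λ a → identity (Formula.neg (Formula.neg p)) p a a a
      }

  isDistributiveBilattice : IsDistributiveBilattice A
  isDistributiveBilattice = record
    { isBilattice = isBilattice
    ; distributes = λ j k _ →
        identity⇒≈ (node j p (node k q r)) (node k (node j p q) (node j p r)) (distrib j k)
    }
    where
    distrib : ∀ j k → Identity (node j p (node k q r)) (node k (node j p q) (node j p r))
    distrib = from-yes (∀Connective? λ j → ∀Connective? λ k →
      identity? (node j p (node k q r)) (node k (node j p q) (node j p r)))

  -- The isomorphism with the square of the regular part.

  R : Lattice ℓ ℓ
  R = Reg isBilattice

  R² : Alg ℓ ℓ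
  R² = ⊙-square R

  reg-regular : ∀ a → reg a ≈ ∼ reg a
  reg-regular a = identity (FmReg.reg p) (Formula.neg (FmReg.reg p)) a a a

  -- Regularity is a hypothesis rather than an identity; rewriting a regular element as `reg a`
  -- brings it within reach of the truth tables.
  regular⇒reg≈ : ∀ {a} → a ≈ ∼ a → reg a ≈ a
  regular⇒reg≈ {a} a≈∼a = begin
    half a ⊕ ∼ half a  ≈⟨ op-cong joinₖ half≈ (neg-cong half≈) ⟩
    a ⊕ ∼ a            ≈⟨ op-cong joinₖ ≈-refl a≈∼a ⟨
    a ⊕ a              ≈⟨ identity (p Fm.⊕ p) p a a a ⟩
    a                  ∎
    where
    half≈ : half a ≈ a
    half≈ = begin
      a ∨ (a ⊗ ∼ a)  ≈⟨ op-cong joinₜ ≈-refl (op-cong meetₖ ≈-refl a≈∼a) ⟨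
      a ∨ (a ⊗ a)    ≈⟨ identity (p Fm.∨ (p Fm.⊗ p)) p a a a ⟩
      a              ∎

  coordinates : Carrier → Alg.Carrier R²
  coordinates a = (reg a , reg-regular a) , (reg (∼ a) , reg-regular (∼ a))

  coordinates-isHomomorphism : IsHomomorphism A R² coordinates
  coordinates-isHomomorphism = record
    { ⟦⟧-cong  = λ a≈b → reg-cong a≈b , reg-cong (neg-cong a≈b)
    ; op-homo  = λ where
        meetₜ a b → reg-op meetₜ meetₖ a b , reg-neg-op meetₜ joinₖ a b
        joinₜ a b → reg-op joinₜ joinₖ a b , reg-neg-op joinₜ meetₖ a b
        meetₖ a b → reg-op meetₖ meetₖ a b , reg-neg-op meetₖ meetₖ a b
        joinₖ a b → reg-op joinₖ joinₖ a b , reg-neg-op joinₖ joinₖ a b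
    ; neg-homo = λ a → ≈-refl , reg-cong (identity (Formula.neg (Formula.neg p)) p a a a)
    }
    where
    reg-op : ∀ j k {_ : True (identity? (FmReg.reg (node j p q))
                                        (node k (FmReg.reg p) (FmReg.reg q)))} →
      ∀ a b → reg (op j a b) ≈ op k (reg a) (reg b)
    reg-op j k {valid} a b =
      identity (FmReg.reg (node j p q)) (node k (FmReg.reg p) (FmReg.reg q)) {valid} a b b

    reg-neg-op : ∀ j k {_ : True (identity? (FmReg.reg (Formula.neg (node j p q)))
        (node k (FmReg.reg (Formula.neg p)) (FmReg.reg (Formula.neg q))))} →
      ∀ a b → reg (∼ (op j a b)) ≈ op k (reg (∼ a)) (reg (∼ b))
    reg-neg-op j k {valid} a b = identity (FmReg.reg (Formula.neg (node j p q)))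
      (node k (FmReg.reg (Formula.neg p)) (FmReg.reg (Formula.neg q))) {valid} a b b

  pair-coordinates : ∀ a → pair (reg a) (reg (∼ a)) ≈ a
  pair-coordinates a =
    identity (FmReg.pair (FmReg.reg p) (FmReg.reg (Formula.neg p))) p a a a

  reg-pair : ∀ {x y} → x ≈ ∼ x → y ≈ ∼ y → reg (pair x y) ≈ x
  reg-pair {x} {y} x≈∼x y≈∼y = begin
    reg (pair x y)              ≈⟨ reg-cong (pair-cong (regular⇒reg≈ x≈∼x) (regular⇒reg≈ y≈∼y)) ⟨
    reg (pair (reg x) (reg y))  ≈⟨ identity (FmReg.reg (FmReg.pair (FmReg.reg p) (FmReg.reg q)))
                                     (FmReg.reg p) x y y ⟩
    reg x                       ≈⟨ regular⇒reg≈ x≈∼x ⟩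
    x                           ∎

  reg-neg-pair : ∀ {x y} → x ≈ ∼ x → y ≈ ∼ y → reg (∼ pair x y) ≈ y
  reg-neg-pair {x} {y} x≈∼x y≈∼y = begin
    reg (∼ pair x y)              ≈⟨ reg-cong (neg-cong
                                       (pair-cong (regular⇒reg≈ x≈∼x) (regular⇒reg≈ y≈∼y))) ⟨
    reg (∼ pair (reg x) (reg y))  ≈⟨ identity
                                       (FmReg.reg (Formula.neg (FmReg.pair (FmReg.reg p) (FmReg.reg q))))
                                       (FmReg.reg q) x y y ⟩
    reg y                         ≈⟨ regular⇒reg≈ y≈∼y ⟩
    y                             ∎

  coordinates-isIsomorphism : IsIsomorphism A R² coordinates
  coordinates-isIsomorphism = record
    { isHomomorphism = coordinates-isHomomorphism
    ; bijective      =
        (λ {a} {b} (a₁≈b₁ , a₂≈b₂) → ≈-trans (≈-sym (pair-coordinates a))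
          (≈-trans (pair-cong a₁≈b₁ a₂≈b₂) (pair-coordinates b)))
      , (λ ((x , x≈∼x) , (y , y≈∼y)) → pair x y , λ z≈ →
            ≈-trans (reg-cong z≈) (reg-pair x≈∼x y≈∼y)
          , ≈-trans (reg-cong (neg-cong z≈)) (reg-neg-pair x≈∼x y≈∼y))
    }

  -- The top element, separation and the generated bifilter.

  -- The total relation is compatible with an empty `F`, so reducedness would identify all elements,
  -- against non-triviality.
  F-nonEmpty : ∃ λ a → a ∈ F
  F-nonEmpty with em {∃ λ a → a ∈ F}
  ... | yes ∃a∈F = ∃a∈F
  ... | no  ∄a∈F = contradiction (greatest (λ _ _ → Lift ℓ Unit) total-isCongruence
      (λ _ a∈F → contradiction (_ , a∈F) ∄a∈F) _) (proj₂ (proj₂ nonTrivial))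
    where
    total-isCongruence : IsCongruence A (λ _ _ → Lift ℓ Unit)
    total-isCongruence = record
      { isEquivalenceᶿ = _
      ; ≈⇒θ            = _
      ; op-congᶿ       = _
      ; neg-congᶿ      = _
      }

  -- If a, b ∈ F then reg a ∨ c and reg b ∨ c are in F for all c.
  ∈F⇒reg≈ : ∀ {a b} → a ∈ F → b ∈ F → reg a ≈ reg b
  ∈F⇒reg≈ {a} {b} a∈F b∈F = ≃⇒≈ (below a b b∈F , below b a a∈F)
    where
    below : ∀ a b → b ∈ F → reg a ⊑ reg b
    below a b b∈F = (λ c _ → F-entails₁ p (FmReg.reg p Fm.∨ q) b c c c b∈F)
                  , (λ c _ → F-entails₁ p (Formula.neg (FmReg.reg p) Fm.∨ q) b c c c b∈F)

  -- By `∈F⇒reg≈` the chosen member of `F` does not matter up to `≈`.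
  top : Carrier
  top = reg (proj₁ F-nonEmpty)

  top-regular : top ≈ ∼ top
  top-regular = reg-regular _

  top∈F : top ∈ F
  top∈F = F-entails₁ p (FmReg.reg p) _ top top top (proj₂ F-nonEmpty)

  ∈F⇒reg≈top : ∀ {a} → a ∈ F → reg a ≈ top
  ∈F⇒reg≈top a∈F = ∈F⇒reg≈ a∈F (proj₂ F-nonEmpty)

  -- `x ⊕ top` is in `F` because `top` is, and it is regular, so it equals its own `reg`, which is
  -- `top`.
  regular-≤-top : ∀ {x} → x ≈ ∼ x → x ≤ₖ top
  regular-≤-top {x} x≈∼x = begin
    x              ≈⟨ identity p (p Fm.⊗ (p Fm.⊕ q)) x top top ⟩
    x ⊗ (x ⊕ top)  ≈⟨ op-cong meetₖ ≈-refl x⊕top≈top ⟩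
    x ⊗ top        ∎
    where
    x⊕top≈top : x ⊕ top ≈ top
    x⊕top≈top = ≈-trans
      (≈-sym (regular⇒reg≈ (≈-trans (op-cong joinₖ x≈∼x top-regular) (≈-sym (neg-⊕ isBilattice x top)))))
      (∈F⇒reg≈top (F-entails₁ q (p Fm.⊕ q) x top top top top∈F))

  -- For regular elements the test on negations coincides with the test on the elements.
  regular-⊑ : ∀ {x y} → x ≈ ∼ x → y ≈ ∼ y → x ≼ y → x ⊑ y
  regular-⊑ x≈∼x y≈∼y x≼y = x≼y , λ c →
    F-resp (op-cong joinₜ y≈∼y ≈-refl) ∘ x≼y c ∘ F-resp (op-cong joinₜ (≈-sym x≈∼x) ≈-refl)

  ≤ₖ⇒≼ : ∀ {x y} → x ≤ₖ y → x ≼ y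
  ≤ₖ⇒≼ {x} {y} x≤y c x∨c∈F =
    F-entails₁ ((p Fm.⊗ q) Fm.∨ r) (q Fm.∨ r) x y c c (≼-reflexive x≤y c x∨c∈F)

  -- Without such a `c` the elements would be congruent: `x ≤ₖ y` gives one half of `x ≃ y`, the
  -- missing witness the other.
  regular-separated : ∀ {x y} → x ≈ ∼ x → y ≈ ∼ y → x ≤ₖ y → x ≉ y →
    ∃ λ c → y ∨ c ∈ F × x ∨ c ∉ F
  regular-separated {x} {y} x≈∼x y≈∼y x≤y x≉y = decidable-stable em λ ∄c →
    x≉y (≃⇒≈ ( regular-⊑ x≈∼x y≈∼y (≤ₖ⇒≼ x≤y)
             , regular-⊑ y≈∼y x≈∼x λ c y∨c∈F → decidable-stable em λ x∨c∉F →
                 ∄c (c , y∨c∈F , x∨c∉F)))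

  Reg-isTopSeparated : IsTopSeparatedLattice R (top , top-regular)
  Reg-isTopSeparated = record
    { isDistributiveLattice = record
      { isLattice   = Lattice.isLattice R
      ; ∨-distrib-∧ =
          (λ (x , _) (y , _) (z , _) → identity (p Fm.⊕ (q Fm.⊗ r)) ((p Fm.⊕ q) Fm.⊗ (p Fm.⊕ r)) x y z)
        , (λ (x , _) (y , _) (z , _) → identity ((q Fm.⊗ r) Fm.⊕ p) ((q Fm.⊕ p) Fm.⊗ (r Fm.⊕ p)) x y z)
      ; ∧-distrib-∨ =
          (λ (x , _) (y , _) (z , _) → identity (p Fm.⊗ (q Fm.⊕ r)) ((p Fm.⊗ q) Fm.⊕ (p Fm.⊗ r)) x y z)
        , (λ (x , _) (y , _) (z , _) → identity ((q Fm.⊕ r) Fm.⊗ p) ((q Fm.⊗ p) Fm.⊕ (r Fm.⊗ p)) x y z)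
      }
    ; maximum   = λ (x , x≈∼x) → regular-≤-top x≈∼x
    ; separated = λ {(x , x≈∼x)} {(y , y≈∼y)} (x≤y , x≉y) →
        let c , y∨c∈F , x∨c∉F = regular-separated x≈∼x y≈∼y x≤y x≉y in
          -- `c` need not be regular; `reg c` can replace it because `x ⊕ reg c` and `x ∨ c` have
          -- the same first coordinate in a square.
          (reg c , reg-regular c)
        , (λ x⊕c≈top → x∨c∉F (F-entails₁ (p Fm.⊕ FmReg.reg q) (p Fm.∨ q) x c c c
            (F-resp (≈-sym x⊕c≈top) top∈F)))
        , (begin
            y ⊕ reg c      ≈⟨ op-cong joinₖ (regular⇒reg≈ y≈∼y) ≈-refl ⟨
            reg y ⊕ reg c  ≈⟨ identity (FmReg.reg p Fm.⊕ FmReg.reg q) (FmReg.reg (p Fm.∨ q)) y c c ⟩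
            reg (y ∨ c)    ≈⟨ ∈F⇒reg≈top y∨c∈F ⟩
            top            ∎)
    }

  F-isBifilter : IsBifilter A F
  F-isBifilter = record
    { nonEmpty  = F-nonEmpty
    ; ∧-closed  = λ {a} {b} → F-entails₂ p q (p Fm.∧ q) a b b b
    ; ⊗-closed  = λ {a} {b} → F-entails₂ p q (p Fm.⊗ q) a b b b
    ; ≤ₜ-closed = λ {a} {b} a∈F a≤b → F-entails₁ (p Fm.∧ q) q a b b b (F-resp a≤b a∈F)
    ; ≤ₖ-closed = λ {a} {b} a∈F a≤b → F-entails₁ (p Fm.⊗ q) q a b b b (F-resp a≤b a∈F)
    }

  F-isLeastBifilterContaining : IsLeastBifilterContaining A top F
  F-isLeastBifilterContaining = record
    { isBifilter = F-isBifilter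
    ; contains   = top∈F
    ; least      = λ G G-isBifilter top∈G {a} a∈F → let open IsBifilter G-isBifilter in
        -- In a square, ⟨a₁,a₁⟩ ≤ₖ ⟨a₁,a₁⊔a₂⟩ ≤ₜ ⟨a₁,a₂⟩.
        ≤ₜ-closed
          (≤ₖ-closed
            (≤ₖ-closed top∈G (begin
              top          ≈⟨ identity p (p Fm.⊗ p) top top top ⟩
              top ⊗ top    ≈⟨ op-cong meetₖ ≈-refl (∈F⇒reg≈top a∈F) ⟨
              top ⊗ reg a  ∎))
            (identity (FmReg.reg p) (FmReg.reg p Fm.⊗ (FmReg.reg p Fm.⊕ p)) a a a))
          (identity (FmReg.reg p Fm.⊕ p) ((FmReg.reg p Fm.⊕ p) Fm.∧ p) a a a)
    }

  characterisation : Σ[ distributive ∈ IsDistributiveBilattice A ]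
    let R = Reg (IsDistributiveBilattice.isBilattice distributive) in
    Isomorphic A (⊙-square R) ×
    (Σ[ top ∈ Lattice.Carrier R ] IsTopSeparatedLattice R top ×
      IsLeastBifilterContaining A (proj₁ top) F)
  characterisation =
      isDistributiveBilattice , (coordinates , coordinates-isIsomorphism)
    , (top , top-regular) , Reg-isTopSeparated , F-isLeastBifilterContaining

-- The Lindenbaum argument in the square of a distributive lattice.

module SquareModel
  (em : ExcludedMiddle ℓ) (L : Lattice c ℓ)
  (isDistributive : IsDistributiveLattice (Lattice._≈_ L) (Lattice._∨_ L) (Lattice._∧_ L))
  (top : Lattice.Carrier L)
  where

  open Lattice L using (Carrier; _∨_; _∧_)
  open IsDistributiveLattice isDistributive using (∨-distribˡ-∧)
  open OrderTheoretic.Lattice (LatticeProperties.∨-∧-orderTheoreticLattice L)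
    using (_≤_; x≤x∨y; y≤x∨y; ∨-least; x∧y≤x; x∧y≤y; ∧-greatest; module Eq)
    renaming (refl to ≤-refl; trans to ≤-trans; reflexive to ≤-reflexive)

  L² : Alg c ℓ
  L² = ⊙-square L

  ∨-monoˡ-≤ : ∀ {x y} z → x ≤ y → x ∨ z ≤ y ∨ z
  ∨-monoˡ-≤ z x≤y = ∨-least (≤-trans x≤y (x≤x∨y _ _)) (y≤x∨y _ _)

  ∨-monoʳ-≤ : ∀ {x y} z → x ≤ y → z ∨ x ≤ z ∨ y
  ∨-monoʳ-≤ z x≤y = ∨-least (x≤x∨y _ _) (≤-trans x≤y (y≤x∨y _ _))

  -- Names the instance of excluded middle, so that `extend` and `bits` refer to the same decision.
  covers? : ∀ e x → Dec (top ≤ e ∨ x)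
  covers? e x = em

  -- If adding `x` would make the ideal below `e` reach `top`, `x` is left out and will count as
  -- true; otherwise it is added and will count as false.
  extend : Carrier → Carrier → Carrier
  extend e x = if does (covers? e x) then e else e ∨ x

  ≤-extend : ∀ e x → e ≤ extend e x
  ≤-extend e x with covers? e x
  ... | yes _ = ≤-refl
  ... | no  _ = x≤x∨y e x

  extend-proper : ∀ {e} x → ¬ top ≤ e → ¬ top ≤ extend e x
  extend-proper {e} x top≰e with covers? e x
  ... | yes _       = top≰e
  ... | no  top≰e∨x = top≰e∨x

  -- The union of the ideals generated by the elements of the chain contains e₀ but not
  -- top, and is prime on the sublattice generated by the coordinates of the values v n.
  module Lindenbaum (v : ℕ → Carrier × Carrier) (e₀ : Carrier) (top≰e₀ : ¬ top ≤ e₀) where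

    -- Each step treats both coordinates of `v n`, with `middle n` between them.
    chain middle : ℕ → Carrier
    chain zero    = e₀
    chain (suc n) = extend (middle n) (proj₂ (v n))
    middle n = extend (chain n) (proj₁ (v n))

    chain-proper : ∀ n → ¬ top ≤ chain n
    chain-proper zero    = top≰e₀
    chain-proper (suc n) = extend-proper _ (extend-proper _ (chain-proper n))

    chain-mono : ∀ {m n} → m ≤′ n → chain m ≤ chain n
    chain-mono (≤′-reflexive refl) = ≤-refl
    chain-mono (≤′-step m≤n)       =
      ≤-trans (chain-mono m≤n) (≤-trans (≤-extend _ _) (≤-extend _ _))

    e₀≤chain : ∀ n → e₀ ≤ chain n
    e₀≤chain n = chain-mono {0} {n} z≤′n

    chain-upperˡ : ∀ m n → chain m ≤ chain (m ⊔ⁿ n)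
    chain-upperˡ m n = chain-mono (≤⇒≤′ (m≤m⊔n m n))

    chain-upperʳ : ∀ m n → chain n ≤ chain (m ⊔ⁿ n)
    chain-upperʳ m n = chain-mono (≤⇒≤′ (m≤n⊔m m n))

    -- Truth is not mere absence from the ideal but the positive statement that `x` joined with a
    -- stage reaches `top`; this form passes through meets and joins.
    Decides : Bool → Carrier → Set ℓ
    Decides true  x = ∃ λ n → top ≤ chain n ∨ x
    Decides false x = ∃ λ n → x ≤ chain n

    -- The deciding stage `e` may be a `middle`, so the verdict is transferred to a `chain m` above
    -- it.
    decides-extend : ∀ {e} x m → e ≤ chain m → extend e x ≤ chain m →
      Decides (does (covers? e x)) x
    decides-extend {e} x m e≤ extend≤ with covers? e x
    ... | yes top≤e∨x = m , ≤-trans top≤e∨x (∨-monoˡ-≤ x e≤)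
    ... | no  _       = m , ≤-trans (y≤x∨y e x) extend≤

    decides-∧ : ∀ a b {x y} → Decides a x → Decides b y → Decides (a ∧ᵇ b) (x ∧ y)
    -- Both witnesses are moved to the later stage, where distributivity pulls the common ideal
    -- element out of the meet.
    decides-∧ true  true  {x} {y} (m , p) (n , q) = m ⊔ⁿ n ,
      ≤-trans (∧-greatest (≤-trans p (∨-monoˡ-≤ x (chain-upperˡ m n)))
                          (≤-trans q (∨-monoˡ-≤ y (chain-upperʳ m n))))
              (≤-reflexive (Eq.sym (∨-distribˡ-∧ _ _ _)))
    decides-∧ true  false _       (n , q) = n , ≤-trans (x∧y≤y _ _) q
    decides-∧ false _     (m , p) _       = m , ≤-trans (x∧y≤x _ _) p

    decides-∨ : ∀ a b {x y} → Decides a x → Decides b y → Decides (a ∨ᵇ b) (x ∨ y)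
    decides-∨ true  _     (m , p) _       = m , ≤-trans p (∨-monoʳ-≤ _ (x≤x∨y _ _))
    decides-∨ false true  _       (n , q) = n , ≤-trans q (∨-monoʳ-≤ _ (y≤x∨y _ _))
    decides-∨ false false (m , p) (n , q) = m ⊔ⁿ n ,
      ∨-least (≤-trans p (chain-upperˡ m n)) (≤-trans q (chain-upperʳ m n))

    Decides² : Bool × Bool → Carrier × Carrier → Set ℓ
    Decides² (a , b) (x , y) = Decides a x × Decides b y

    decides²-op : ∀ k {a b x y} → Decides² a x → Decides² b y →
      Decides² (Alg.op (⊙-square ∨-∧-lattice) k a b) (Alg.op L² k x y)
    decides²-op meetₜ (d₁ , d₂) (e₁ , e₂) = decides-∧ _ _ d₁ e₁ , decides-∨ _ _ d₂ e₂
    decides²-op joinₜ (d₁ , d₂) (e₁ , e₂) = decides-∨ _ _ d₁ e₁ , decides-∧ _ _ d₂ e₂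
    decides²-op meetₖ (d₁ , d₂) (e₁ , e₂) = decides-∧ _ _ d₁ e₁ , decides-∧ _ _ d₂ e₂
    decides²-op joinₖ (d₁ , d₂) (e₁ , e₂) = decides-∨ _ _ d₁ e₁ , decides-∨ _ _ d₂ e₂

    bits : ℕ → Bool × Bool
    bits n = does (covers? (chain n) (proj₁ (v n))) , does (covers? (middle n) (proj₂ (v n)))

    decides²-bits : ∀ n → Decides² (bits n) (v n)
    decides²-bits n =
        -- Stage `suc n` serves both coordinates: `middle n` lies below it, and the second extension
        -- is that stage.
        decides-extend _ (suc n) (≤-trans (≤-extend _ _) (≤-extend _ _)) (≤-extend _ _)
      , decides-extend _ (suc n) (≤-extend _ _) ≤-refl

    valuation : ℕ → Four
    valuation = fromBits ∘ bits

    decides²-⟦⟧ : ∀ φ → Decides² (toBits (⟦ FOUR ⟧ φ valuation)) (⟦ L² ⟧ φ v)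
    decides²-⟦⟧ (var n) rewrite toBits∘fromBits (bits n) = decides²-bits n
    decides²-⟦⟧ (node k φ ψ)
      rewrite toBits-op k (⟦ FOUR ⟧ φ valuation) (⟦ FOUR ⟧ ψ valuation)
      = decides²-op k (decides²-⟦⟧ φ) (decides²-⟦⟧ ψ)
    decides²-⟦⟧ (Formula.neg φ)
      rewrite toBits-neg (⟦ FOUR ⟧ φ valuation)
      = let d₁ , d₂ = decides²-⟦⟧ φ in d₂ , d₁

    -- At `𝖿` and `⊥` the first bit is false, which would place `top` below a proper stage.
    top≤⇒Tr : ∀ x {l} → Decides² (toBits x) l → top ≤ proj₁ l → x ∈ Tr
    top≤⇒Tr 𝖿 ((n , l≤) , _) top≤l = contradiction (≤-trans top≤l l≤) (chain-proper n)
    top≤⇒Tr ⊥ ((n , l≤) , _) top≤l = contradiction (≤-trans top≤l l≤) (chain-proper n)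
    top≤⇒Tr ⊤ _ _ = inj₁ refl
    top≤⇒Tr 𝗍 _ _ = inj₂ refl

    -- If the first coordinate were below `e₀`, joining it to a stage would add nothing, and that
    -- stage would already reach `top`.
    Tr⇒≰e₀ : ∀ x {l} → Decides² (toBits x) l → x ∈ Tr → ¬ proj₁ l ≤ e₀
    Tr⇒≰e₀ x d (inj₁ refl) l≤e₀ = let (n , top≤) , _ = d in
      chain-proper n (≤-trans top≤ (∨-least ≤-refl (≤-trans l≤e₀ (e₀≤chain n))))
    Tr⇒≰e₀ x d (inj₂ refl) l≤e₀ = let (n , top≤) , _ = d in
      chain-proper n (≤-trans top≤ (∨-least ≤-refl (≤-trans l≤e₀ (e₀≤chain n))))

  ⊨-sound : ∀ {Γ : Pred Formula f} {φ} → Γ ⊨ φ → ∀ v →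
    (∀ {γ} → γ ∈ Γ → top ≤ proj₁ (⟦ L² ⟧ γ v)) → top ≤ proj₁ (⟦ L² ⟧ φ v)
  ⊨-sound {φ = φ} Γ⊨φ v Γ-top = decidable-stable em λ top≰φ →
    let open Lindenbaum v (proj₁ (⟦ L² ⟧ φ v)) top≰φ in
    Tr⇒≰e₀ _ (decides²-⟦⟧ φ)
      (Γ⊨φ (λ γ → ⟦ FOUR ⟧ γ valuation) (⟦⟧-isHomomorphism FOUR valuation)
        (λ {γ} γ∈Γ → top≤⇒Tr _ (decides²-⟦⟧ γ) (Γ-top γ∈Γ)))
      ≤-refl

-- Separated squares give reduced models.

module SeparatedSquare
  (em : ExcludedMiddle ℓ) (A : Alg ℓ ℓ) (F : Pred (Alg.Carrier A) ℓ)
  (F-resp : F Respects Alg._≈_ A)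
  (L : Lattice ℓ ℓ) {top : Lattice.Carrier L} (isTopSeparated : IsTopSeparatedLattice L top)
  {g : Alg.Carrier A → Lattice.Carrier L × Lattice.Carrier L}
  (g-isIsomorphism : IsIsomorphism A (⊙-square L) g)
  {t : Alg.Carrier A} (g-t : Alg._≈_ (⊙-square L) (g t) (top , top))
  (F-isLeast : IsLeastBifilterContaining A t F)
  where

  open Alg A renaming (neg to ∼_; _∧_ to _∧ₜ_; _∨_ to _∨ₜ_)
  open IsEquivalence isEquivalence
    renaming (refl to ≈-refl; sym to ≈-sym; trans to ≈-trans)
  open IsIsomorphism g-isIsomorphism
  open IsHomomorphism isHomomorphism renaming (⟦⟧-cong to g-cong)
  open IsTopSeparatedLattice isTopSeparated
  open IsLeastBifilterContaining F-isLeast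
  open IsBifilter isBifilter using (≤ₜ-closed)
  open Lattice L using (_∨_; _∧_)
  open LatticeProperties L using (∧-idem; ∨-∧-orderTheoreticLattice)
  open OrderTheoretic.Lattice ∨-∧-orderTheoreticLattice
    using (_≤_; antisym; x∧y≤x; ∧-greatest; ∨-least; x≤x∨y)
    renaming (refl to ≤-refl; trans to ≤-trans; reflexive to ≤-reflexive)
  module L = Lattice L
  module L² = Alg (⊙-square L)

  fst : Carrier → L.Carrier
  fst = proj₁ ∘ g

  fst-op : ∀ k a b → fst (op k a b) L.≈ proj₁ (L².op k (g a) (g b))
  fst-op k a b = proj₁ (op-homo k a b)

  fst-cong : ∀ {a b} → a ≈ b → fst a L.≈ fst b
  fst-cong = proj₁ ∘ g-cong

  fst-mono : ∀ {a b} → a ≤ₜ b ⊎ a ≤ₖ b → fst a ≤ fst b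
  fst-mono {a} {b} (inj₁ a≤b) = L.trans (fst-cong a≤b) (fst-op meetₜ a b)
  fst-mono {a} {b} (inj₂ a≤b) = L.trans (fst-cong a≤b) (fst-op meetₖ a b)

  Designated : Pred Carrier ℓ
  Designated a = top ≤ fst a

  Designated-isBifilter : IsBifilter A Designated
  Designated-isBifilter = record
    { nonEmpty  = t , ≤-reflexive (L.sym (proj₁ g-t))
    ; ∧-closed  = λ {a} {b} a∈ b∈ →
        ≤-trans (∧-greatest a∈ b∈) (≤-reflexive (L.sym (fst-op meetₜ a b)))
    ; ⊗-closed  = λ {a} {b} a∈ b∈ →
        ≤-trans (∧-greatest a∈ b∈) (≤-reflexive (L.sym (fst-op meetₖ a b)))
    ; ≤ₜ-closed = λ a∈ a≤b → ≤-trans a∈ (fst-mono (inj₁ a≤b))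
    ; ≤ₖ-closed = λ a∈ a≤b → ≤-trans a∈ (fst-mono (inj₂ a≤b))
    }

  ∈F⇒Designated : ∀ {a} → a ∈ F → Designated a
  ∈F⇒Designated =
    -- The witness of non-emptiness was chosen to be `t`, so its proof says that `t` is designated.
    least Designated Designated-isBifilter (IsBifilter.nonEmpty Designated-isBifilter .proj₂)

  -- `≤ₜ` reverses the second coordinate, so `⟨top,top⟩` is truth-below every pair with first
  -- coordinate `top`; injectivity of `g` turns this into `t ≤ₜ a`.
  Designated⇒∈F : ∀ {a} → Designated a → a ∈ F
  Designated⇒∈F {a} top≤a = ≤ₜ-closed contains (proj₁ bijective (begin
    g t                    ≈⟨ g-t ⟩
    top , top              ≈⟨ top≤a , antisym (x≤x∨y _ _) (∨-least ≤-refl (maximum _)) ⟩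
    (top , top) L².∧ g a   ≈⟨ L².op-cong meetₜ g-t (L.refl , L.refl) ⟨
    g t L².∧ g a           ≈⟨ op-homo meetₜ t a ⟨
    g (t ∧ₜ a)             ∎))
    where open ≈-Reasoning L².setoid

  -- `g ∘ h` is evaluation at its values on the variables, so `⊨-sound` applies in the square, where
  -- `F` is read off first coordinates.
  isModel : IsModel A F
  isModel Γ φ Γ⊨φ h isHom Γ⊆F = Designated⇒∈F (≤-trans
    (⊨-sound Γ⊨φ (g ∘ h ∘ var) (λ {γ} γ∈Γ →
      ≤-trans (∈F⇒Designated (Γ⊆F γ∈Γ)) (≤-reflexive (proj₁ (coordinates γ)))))
    (≤-reflexive (L.sym (proj₁ (coordinates φ)))))
    where
    open SquareModel em L isDistributiveLattice top using (⊨-sound)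

    coordinates : ∀ γ → g (h γ) L².≈ ⟦ ⊙-square L ⟧ γ (g ∘ h ∘ var)
    coordinates γ = IsEquivalence.trans L².isEquivalence
      (g-cong (hom-⟦⟧ A isHom γ)) (⟦⟧-natural isHomomorphism γ (h ∘ var))

  fst-test : ∀ a b {D d} → fst D L.≈ d → fst ((a ∧ₜ b) ∨ₜ D) L.≈ (fst a ∧ fst b) ∨ d
  fst-test a b D≈d = L.trans (fst-op joinₜ _ _) (L.∨-cong (fst-op meetₜ a b) D≈d)

  module _ {θ : Rel Carrier ℓ} (θ-isCongruence : IsCongruence A θ) (F-respθ : F Respects θ) where
    open IsCongruence θ-isCongruence
    open IsEquivalence isEquivalenceᶿ using () renaming (refl to θ-refl; sym to θ-sym)

    -- If fst a ≰ fst b, the witness d separating fst a ∧ fst b from fst a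
    -- gives (a ∧ a) ∨ ⟨d,d⟩ ∈ F but (a ∧ b) ∨ ⟨d,d⟩ ∉ F.
    θ⇒fst≤ : ∀ {a b} → θ a b → fst a ≤ fst b
    θ⇒fst≤ {a} {b} aθb = decidable-stable em λ a≰b →
      let d , a∧b∨d≉top , a∨d≈top = separated
            (x∧y≤x _ _ , λ a∧b≈a → a≰b (L.sym a∧b≈a))
          D , gD≈ = proj₂ bijective (d , d)
          fstD≈d = proj₁ (gD≈ ≈-refl)
          -- Writing `a ∧ₜ a` for `a` lets the congruence replace only the second occurrence by `b`.
          a∧a∨D∈F = Designated⇒∈F (≤-reflexive (L.sym (L.trans (fst-test a a fstD≈d)
            (L.trans (L.∨-congʳ (∧-idem _)) a∨d≈top))))
          a∧b∨D∈F = F-respθ (op-congᶿ joinₜ (op-congᶿ meetₜ θ-refl aθb) θ-refl) a∧a∨D∈F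
      in a∧b∨d≉top (antisym (maximum _)
           (≤-trans (∈F⇒Designated a∧b∨D∈F) (≤-reflexive (fst-test a b fstD≈d))))

    θ⇒fst≈ : ∀ {a b} → θ a b → fst a L.≈ fst b
    θ⇒fst≈ aθb = antisym (θ⇒fst≤ aθb) (θ⇒fst≤ (θ-sym aθb))

    -- The second coordinate is the first coordinate of the negation, and `θ` respects negation.
    θ⇒≈ : ∀ {a b} → θ a b → a ≈ b
    θ⇒≈ {a} {b} aθb = proj₁ bijective
      ( θ⇒fst≈ aθb
      , L.trans (L.sym (proj₁ (neg-homo a)))
          (L.trans (θ⇒fst≈ (neg-congᶿ aθb)) (proj₁ (neg-homo b))))

  isReducedModel : IsReducedModel A F
  isReducedModel = isModel , record
    { isCongruence = record
      { isEquivalenceᶿ = isEquivalence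
      ; ≈⇒θ            = id
      ; op-congᶿ       = op-cong
      ; neg-congᶿ      = neg-cong
      }
    ; compatible = F-resp
    ; greatest   = λ _ → θ⇒≈
    }

-- Locating the top of the square, and both implications.

-- The preimage of ⟨⊤,⊤⟩ is regular, hence below ⊤.
isomorphism-top : ∀ {A : Alg c ℓ} (bl : IsBilattice A) (let R = Reg bl)
  {g : Alg.Carrier A → Lattice.Carrier R × Lattice.Carrier R} →
  IsIsomorphism A (⊙-square R) g →
  ∀ top → Maximum (LatticeOrder._≤_ R) top →
  Alg._≈_ (⊙-square R) (g (proj₁ top)) (top , top)
isomorphism-top {A = A} bl {g} isIso top maximum =
    antisym {proj₁ (g t)} {top} (maximum (proj₁ (g t))) (proj₁ top≈)
  , antisym {proj₂ (g t)} {top} (maximum (proj₂ (g t))) (proj₂ top≈)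
  where
  open Alg A renaming (neg to ∼_)
  module R² = Alg (⊙-square (Reg bl))
  open IsIsomorphism isIso
  open IsHomomorphism isHomomorphism renaming (⟦⟧-cong to g-cong)
  open OrderTheoretic.Lattice (LatticeProperties.∨-∧-orderTheoreticLattice (Reg bl))
    using (antisym)
  open ≈-Reasoning R².setoid

  t a : Carrier
  t = proj₁ top
  a = proj₁ (proj₂ bijective (top , top))

  ga≈top : g a R².≈ (top , top)
  ga≈top = proj₂ (proj₂ bijective (top , top)) (IsEquivalence.refl isEquivalence)

  a-regular : a ≈ ∼ a
  a-regular = proj₁ bijective (begin
    g a           ≈⟨ ga≈top ⟩
    top , top     ≈⟨ R².neg-cong {g a} {top , top} ga≈top ⟨
    R².neg (g a)  ≈⟨ neg-homo a ⟨
    g (∼ a)       ∎)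

  top≈ : (top , top) R².≈ (top , top) R².⊗ g t
  top≈ = begin
    top , top             ≈⟨ ga≈top ⟨
    g a                   ≈⟨ g-cong (maximum (a , a-regular)) ⟩
    g (a ⊗ t)             ≈⟨ op-homo meetₖ a t ⟩
    g a R².⊗ g t          ≈⟨ R².op-cong meetₖ {g a} {top , top} {g t} {g t} ga≈top
                               (IsEquivalence.refl R².isEquivalence {g t}) ⟩
    (top , top) R².⊗ g t  ∎

theorem3p4p17 : ∀ {ℓ : Level} → ExcludedMiddle ℓ →
    (A : Alg ℓ ℓ) → NonTrivial A →
    (F : Pred (Alg.Carrier A) ℓ) → F Respects (Alg._≈_ A) →
    IsReducedModel A F
    ⇔
    (Σ[ distributive ∈ IsDistributiveBilattice A ]
    let R = Reg (IsDistributiveBilattice.isBilattice distributive) in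
    Isomorphic A (⊙-square R) ×
    (Σ[ ⊤ ∈ Lattice.Carrier R ]
    IsTopSeparatedLattice R ⊤ ×
    IsLeastBifilterContaining A (proj₁ ⊤) F))
theorem3p4p17 em A nonTrivial F F-resp = mk⇔
  (λ (isModel , isReduced) →
    ReducedModel.characterisation em A nonTrivial F F-resp isModel isReduced)
  (λ (distributive , (_ , isIso) , top , isTopSeparated , isLeast) →
    let bl = IsDistributiveBilattice.isBilattice distributive in
    SeparatedSquare.isReducedModel em A F F-resp (Reg bl) isTopSeparated isIso
      (isomorphism-top bl isIso top (IsTopSeparatedLattice.maximum isTopSeparated)) isLeast)
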